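{- Let $G$ be a connected map-rich graph without loops all of whose vertices have odd degree. Let $\gamma$ be the dimension of the bicycle space of $G$ and $v=|V(G)|$. Then the maximum number $\alpha$ of pairwise non-adjacent vertices of $G$ satisfies $\alpha\le v-1-\gamma$. In particular, if $G$ is planar, then $\alpha\le v-z$, where $z$ is the number of zigzag paths in a planar realization of $G$.
   Context: A map is a triple $M=(C_M,v_M,f_M)$ where $C_M$ is a finite cubic graph (multiple edges allowed) and $v_M,f_M$ are disjoint perfect matchings whose union is a disjoint union of 4-cycles, the squares ($SQ(M)$). $a_M=E(C_M)\setminus(v_M\cup f_M)$; $z_M$ is the matching formed by the diagonals of the squares; $Q_M=C_M\cup z_M$. For a map $X$, $G_X$ has vertices the cycles of $v_X\cup a_X$ and edges the squares, each square joining the cycles containing its two $v_X$-edges. The dual is $D=(C_M,f_M,v_M)$, the phial $P=(Q_M\setminus v_M,z_M,f_M)$; $V,F,Z$ are the $GF(2)$-coboundary spaces of $G_M,G_D,G_P$ (subsets of $SQ(M)$), $V^\perp$ the cycle space of $G_M$. $M$ is rich if $V^\perp=F+Z$; $G$ is map-rich if $G\cong G_M$ for a rich map $M$. The bicycle space of a graph is the intersection of its cycle space and coboundary space. $\chi(M)=\#(v_M\cup a_M\text{ -cycles})-|SQ(M)|+\#(f_M\cup a_M\text{ -cycles})$; a planar map is one with $C_M$ connected and $\chi(M)=2$. For planar $G$, the number of zigzag paths of a planar realization is the number of cycles of $z_M\cup a_M$ (in $Q_M$) for a planar map $M$ with $G_M\cong G$ (equivalently, the number of Petrie walks of a plane embedding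 of $G$). -}

module Defs where

open import Algebra.Bundles using (CommutativeRing)
open import Algebra.Definitions using (Involutive)
import Algebra.Properties.Semiring.Sum as SemiringSum
open import Data.Bool.Base using (Bool; false; true; _xor_; _∧_; if_then_else_)
open import Data.Bool.Properties using (xor-∧-commutativeRing)
open import Data.Fin.Base using (Fin; zero; suc; punchOut; punchIn)
open import Data.Fin.Properties using (_≟_; punchOut-cong; punchOut-injective; punchOut-punchIn; punchInᵢ≢i)
open import Data.Fin.Subset using (Subset; _∈_; ∣_∣)
open import Data.Integer.Base as ℤ using (ℤ; +_)
open import Data.List.Base as List using (List; []; _∷_; concatMap)
import Data.List.Membership.Propositional as List
open import Data.List.Membership.Propositional.Properties
  using (∈-concatMap⁺; ∈-concatMap⁻; ∈-tabulate⁺; ∈-tabulate⁻)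
open import Data.List.Relation.Unary.Any as Any using (Any; here; there)
open import Data.Nat.Base using (ℕ; zero; suc; _+_; _≤_; _<_)
open import Data.Nat.Divisibility using (_∣_)
open import Data.Nat.Properties using (+-*-semiring)
open import Data.Product.Base using (Σ-syntax; ∃-syntax; _×_; _,_)
open import Data.Sum.Base using (_⊎_)
open import Data.Vec.Functional using (Vector)
open import Function.Base using (_∘_; id)
open import Function.Bundles using (_↔_; _⇔_; module Inverse)
open import Level using (0ℓ)
open import Relation.Binary.Construct.Closure.Equivalence as Eq using (EqClosure)
open import Relation.Binary.Construct.Closure.ReflexiveTransitive using (ε; _◅_; _◅◅_)
open import Relation.Binary.Construct.Closure.Symmetric using (fwd)
open import Relation.Binary.Core using (Rel; _⇒_)
open import Relation.Binary.PropositionalEquality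
  using (_≡_; _≢_; _≗_; refl; sym; trans; cong; isEquivalence; module ≡-Reasoning)
open import Relation.Nullary using (¬_; does; yes; no; contradiction)
open import Relation.Unary using (Pred; _∩_)

module GF2 = SemiringSum (CommutativeRing.semiring xor-∧-commutativeRing)
module NatSum = SemiringSum +-*-semiring

-- A vector is also read as the set of the i with X i ≡ true; addition
-- (_xor_) is then symmetric difference.

Space : ℕ → Set₁
Space m = Pred (Vector Bool m) 0ℓ

_⊕_ : ∀ {m} → Space m → Space m → Space m
(W₁ ⊕ W₂) X = ∃[ Y₁ ] ∃[ Y₂ ] W₁ Y₁ × W₂ Y₂ × (∀ i → X i ≡ Y₁ i xor Y₂ i)

combination : ∀ {d m} → Vector Bool d → (Fin d → Vector Bool m) → Vector Bool m
combination c b i = GF2.sum (λ j → c j ∧ b j i)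

record HasDimension {m} (W : Space m) (d : ℕ) : Set where
  field
    basis       : Fin d → Vector Bool m
    basis∈      : ∀ j → W (basis j)
    independent : ∀ c → (∀ i → combination c basis i ≡ false) → ∀ j → c j ≡ false
    spanning    : ∀ X → W X → ∃[ c ] X ≗ combination c basis

-- Loops and multiple edges are allowed, and the order of the two ends of
-- an edge carries no meaning.
record Graph : Set where
  field
    #V #E     : ℕ
    end₁ end₂ : Fin #E → Fin #V

  Joins : Fin #E → Fin #V → Fin #V → Set
  Joins e u w = (end₁ e ≡ u × end₂ e ≡ w) ⊎ (end₁ e ≡ w × end₂ e ≡ u)

  Adjacent : Rel (Fin #V) 0ℓ
  Adjacent u w = ∃[ e ] Joins e u w

  -- The empty graph is not connected.
  Connected : Set
  Connected = 0 < #V × (∀ u w → EqClosure Adjacent u w)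

  Loopless : Set
  Loopless = ∀ e → end₁ e ≢ end₂ e

  -- How often e is incident with u: 2 for a loop at u.
  incidence : Fin #V → Fin #E → ℕ
  incidence u e = (if does (end₁ e ≟ u) then 1 else 0)
                + (if does (end₂ e ≟ u) then 1 else 0)

  degreeIn : Vector Bool #E → Fin #V → ℕ
  degreeIn X u = NatSum.sum (λ e → if X e then incidence u e else 0)

  degree : Fin #V → ℕ
  degree = degreeIn (λ _ → true)

  AllDegreesOdd : Set
  AllDegreesOdd = ∀ u → ¬ 2 ∣ degree u

  Coboundary : Space #E
  Coboundary X = Σ[ S ∈ Vector Bool #V ] ∀ e → X e ≡ S (end₁ e) xor S (end₂ e)

  Cycle : Space #E
  Cycle X = ∀ u → 2 ∣ degreeIn X u

  Bicycle : Space #E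
  Bicycle = Cycle ∩ Coboundary

  Independent : Subset #V → Set
  Independent S = ∀ u w → u ∈ S → w ∈ S → u ≢ w → ¬ Adjacent u w

  IsIndependenceNumber : ℕ → Set
  IsIndependenceNumber α = (∃[ S ] Independent S × ∣ S ∣ ≡ α)
                         × (∀ S → Independent S → ∣ S ∣ ≤ α)

open Graph public using
  (#V; #E; Connected; Loopless; AllDegreesOdd; Coboundary; Cycle; Bicycle; IsIndependenceNumber)

record _≅_ (G H : Graph) : Set where
  field
    onV   : Fin (#V G) ↔ Fin (#V H)
    onE   : Fin (#E G) ↔ Fin (#E H)
    joins : ∀ e → Graph.Joins H (Inverse.to onE e)
                    (Inverse.to onV (Graph.end₁ G e)) (Inverse.to onV (Graph.end₂ G e))

-- For an equivalence relation R, this exhibits Fin #classes as the set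
-- of its classes.

record Classes {n : ℕ} (R : Rel (Fin n) 0ℓ) : Set where
  field
    #classes  : ℕ
    class     : Fin n → Fin #classes
    rep       : Fin #classes → Fin n
    class-rep : ∀ c → class (rep c) ≡ c
    sound     : ∀ {x y} → R x y → class x ≡ class y
    complete  : ∀ {x y} → class x ≡ class y → R x y

open Classes public

module _ {n : ℕ} where

  convert : {R R′ : Rel (Fin n) 0ℓ} → R ⇒ R′ → R′ ⇒ R → Classes R → Classes R′
  convert to from C = record
    { #classes = #classes C ; class = class C ; rep = rep C ; class-rep = class-rep C
    ; sound = sound C ∘ from ; complete = to ∘ complete C }

  Linked : List (Fin n × Fin n) → Rel (Fin n) 0ℓ
  Linked L = EqClosure (λ x y → (x , y) List.∈ L)

  private
    weaken : ∀ {l L} → Linked L ⇒ Linked (l ∷ L)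
    weaken = Eq.map there

    flip-linked : ∀ {L} → ∀ {x y} → Linked L x y → Linked L y x
    flip-linked = Eq.symmetric _

    extend : ∀ {p q L} {A : Set} (f : Fin n → A) → (∀ {x y} → Linked L x y → f x ≡ f y) →
             f p ≡ f q → ∀ {x y} → Linked ((p , q) ∷ L) x y → f x ≡ f y
    extend {L = L} f ok fp≡fq = Eq.gfold isEquivalence f step
      where
      step : ∀ {x y} → (x , y) List.∈ (_ ∷ L) → f x ≡ f y
      step (here refl) = fp≡fq
      step (there m)   = ok (fwd m ◅ ε)

    merge : ∀ p q {L} → Classes (Linked L) → Classes (Linked ((p , q) ∷ L))
    merge p q C with class C p ≟ class C q
    ... | yes p≡q = record
      { #classes = #classes C ; class = class C ; rep = rep C ; class-rep = class-rep C
      ; sound = extend (class C) (sound C) p≡q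
      ; complete = weaken ∘ complete C }
    merge p q {L} record { #classes = zero ; class = cl } | no _ with () ← cl p
    merge p q {L} C@record { #classes = suc k ; class = cl ; rep = r ; class-rep = cr } | no p≢q = record
      { #classes = k
      ; class = squash ∘ cl
      ; rep = r ∘ punchIn (cl p)
      ; class-rep = class-rep′
      ; sound = extend (squash ∘ cl) (cong squash ∘ sound C) squash-pq
      ; complete = λ {x} {y} → complete′ x y }
      where
      squash : Fin (suc k) → Fin k
      squash i with cl p ≟ i
      ... | yes _   = punchOut p≢q
      ... | no p≢i = punchOut p≢i

      squash-pq : squash (cl p) ≡ squash (cl q)
      squash-pq with cl p ≟ cl p | cl p ≟ cl q
      ... | yes _   | yes p≡q = contradiction p≡q p≢q
      ... | yes _   | no _    = punchOut-cong (cl p) refl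
      ... | no p≢p  | _       = contradiction refl p≢p

      squash-in : ∀ c → squash (punchIn (cl p) c) ≡ c
      squash-in c with cl p ≟ punchIn (cl p) c
      ... | yes e = contradiction (sym e) (punchInᵢ≢i (cl p) c)
      ... | no _  = trans (punchOut-cong (cl p) refl) (punchOut-punchIn (cl p))

      class-rep′ : ∀ c → squash (cl (r (punchIn (cl p) c))) ≡ c
      class-rep′ c = trans (cong squash (cr _)) (squash-in c)

      lift : ∀ {x y} → cl x ≡ cl y → Linked ((p , q) ∷ L) x y
      lift = weaken ∘ complete C

      pq : Linked ((p , q) ∷ L) p q
      pq = fwd (here refl) ◅ ε

      complete′ : ∀ x y → squash (cl x) ≡ squash (cl y) → Linked ((p , q) ∷ L) x y
      complete′ x y eq with cl p ≟ cl x | cl p ≟ cl y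
      ... | yes p≡x | yes p≡y = lift (trans (sym p≡x) p≡y)
      ... | yes p≡x | no p≢y  = lift (sym p≡x) ◅◅ pq ◅◅ lift (punchOut-injective p≢q p≢y eq)
      ... | no p≢x  | yes p≡y = lift (punchOut-injective p≢x p≢q eq) ◅◅ flip-linked pq ◅◅ lift p≡y
      ... | no p≢x  | no p≢y  = lift (punchOut-injective p≢x p≢y eq)

  linkedClasses : ∀ L → Classes (Linked L)
  linkedClasses [] = record
    { #classes = n ; class = id ; rep = id ; class-rep = λ _ → refl
    ; sound = Eq.fold isEquivalence (λ ()) ; complete = λ { refl → ε } }
  linkedClasses ((p , q) ∷ L) = merge p q (linkedClasses L)

-- A perfect matching on the vertex set Fin n is given by the function
-- taking each vertex to the one it is matched with; its edges are the
-- pairs {x , mate x}.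

record Matching (n : ℕ) : Set where
  field
    mate            : Fin n → Fin n
    mate-involutive : Involutive _≡_ mate
    mate-≢          : ∀ x → mate x ≢ x

open Matching public

module _ {n : ℕ} where

  Step : List (Matching n) → Rel (Fin n) 0ℓ
  Step ms x y = Any (λ m → mate m x ≡ y) ms

  SameComponent : List (Matching n) → Rel (Fin n) 0ℓ
  SameComponent ms = EqClosure (Step ms)

  components : ∀ ms → Classes (SameComponent ms)
  components ms = convert (Eq.map to) (Eq.map from) (linkedClasses (concatMap edges ms))
    where
    edges : Matching n → List (Fin n × Fin n)
    edges m = List.tabulate (λ x → x , mate m x)

    to : ∀ {x y} → (x , y) List.∈ concatMap edges ms → Step ms x y
    to = Any.map (λ {m} → edge⁻ {m}) ∘ ∈-concatMap⁻ edges
      where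
      edge⁻ : ∀ {m x y} → (x , y) List.∈ edges m → mate m x ≡ y
      edge⁻ {m} xy∈ with _ , refl ← ∈-tabulate⁻ {f = λ x → x , mate m x} xy∈ = refl

    from : ∀ {x y} → Step ms x y → (x , y) List.∈ concatMap edges ms
    from = ∈-concatMap⁺ edges ∘ Any.map (λ { refl → ∈-tabulate⁺ _ })

  -- The union of two perfect matchings is a disjoint union of cycles
  -- (of length 2 where they share a pair), which are its components.
  cycles : (m m′ : Matching n) → Classes (SameComponent (m ∷ m′ ∷ []))
  cycles m m′ = components (m ∷ m′ ∷ [])

-- The edge set of the cubic graph C is the disjoint union of the perfect
-- matchings v, f and a. A pair of vertices may be matched by a as well
-- as by v or f: these are multiple edges of C. The last two fields say
-- that alternating v and f closes up after four steps but not after two,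
-- that is, the components of v ∪ f are 4-cycles.

record Map (n : ℕ) : Set where
  field
    v f a   : Matching n
    v≢f     : ∀ x → mate v x ≢ mate f x
    squares : ∀ x → mate f (mate v (mate f (mate v x))) ≡ x

  -- Going along v and then f leads to the opposite vertex of the square,
  -- so these are the diagonals.
  z : Matching n
  z = record
    { mate = λ x → mate f (mate v x)
    ; mate-involutive = squares
    ; mate-≢ = λ x fvx≡x → v≢f x
        (trans (sym (mate-involutive f (mate v x))) (cong (mate f) fvx≡x))
    }

  SQ : Classes (SameComponent (v ∷ f ∷ []))
  SQ = cycles v f

  #SQ : ℕ
  #SQ = #classes SQ

open Map public using (#SQ)

module _ {n : ℕ} (M : Map n) where
  open Map M hiding (#SQ)

  private
    zz : ∀ x → mate v (mate f x) ≡ mate f (mate v x)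
    zz x = begin
      mate v (mate f x)                                                        ≡⟨ sym (squares _) ⟩
      mate f (mate v (mate f (mate v (mate v (mate f x)))))                    ≡⟨ cong (λ y → mate f (mate v (mate f y))) (mate-involutive v _) ⟩
      mate f (mate v (mate f (mate f x)))                                      ≡⟨ cong (λ y → mate f (mate v y)) (mate-involutive f x) ⟩
      mate f (mate v x)                                                        ∎
      where open ≡-Reasoning

  dual : Map n
  dual = record
    { v = f ; f = v ; a = a
    ; v≢f = λ x → v≢f x ∘ sym
    ; squares = λ x → trans (cong (λ y → mate v (mate f y)) (zz x))
        (trans (cong (mate v) (mate-involutive f _)) (mate-involutive v x))
    }

  phial : Map n
  phial = record
    { v = z ; f = f ; a = a
    ; v≢f = λ x fvx≡fx → mate-≢ v x
        (trans (sym (mate-involutive f _)) (trans (cong (mate f) fvx≡fx) (mate-involutive f x)))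
    ; squares = λ x → trans (mate-involutive f _)
        (trans (cong (mate v) (mate-involutive f _)) (mate-involutive v x))
    }

  -- The square with vertices x , v x , f x , f (v x) has the two v-edges
  -- {x , v x} and {f x , f (v x)}, so it joins the (v ∪ a)-cycles of x
  -- and of f x.
  graph : Graph
  graph = record
    { #V = #classes (cycles v a)
    ; #E = #SQ M
    ; end₁ = λ s → class (cycles v a) (rep SQ s)
    ; end₂ = λ s → class (cycles v a) (mate f (rep SQ s))
    }

  C-Connected : Set
  C-Connected = 0 < n × (∀ x y → SameComponent (v ∷ f ∷ a ∷ []) x y)

  χ : ℤ
  χ = + #classes (cycles v a) ℤ.- + #SQ M ℤ.+ + #classes (cycles f a)

  Planar : Set
  Planar = C-Connected × χ ≡ + 2

  #zigzags : ℕ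
  #zigzags = #classes (cycles z a)

-- M, its dual and its phial have the same squares as vertex sets, but
-- possibly numbered differently. This reads a set of squares of M as a
-- set of squares of X, for X one of the three.

renumber : ∀ {n} (M X : Map n) → Vector Bool (#SQ M) → Vector Bool (#SQ X)
renumber M X Y s = Y (class (Map.SQ M) (rep (Map.SQ X) s))

module _ {n : ℕ} (M : Map n) where

  V⊥-space F-space Z-space : Space (#SQ M)
  V⊥-space  = Cycle (graph M)
  F-space Y = Coboundary (graph (dual M)) (renumber M (dual M) Y)
  Z-space Y = Coboundary (graph (phial M)) (renumber M (phial M) Y)

  Rich : Set
  Rich = ∀ X → V⊥-space X ⇔ (F-space ⊕ Z-space) X

MapRich : Graph → Set
MapRich G = ∃[ n ] Σ[ M ∈ Map n ] Rich M × G ≅ graph M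

{-# OPTIONS --safe #-}
module Submission where

-- The stars of the α independent vertices are pairwise orthogonal, and each is
-- not orthogonal to itself because its degree is odd; so they are independent of
-- any space orthogonal to V. The bicycle space is such a subspace of V, whence
-- α + γ ≤ dim V = v - 1. For a planar map, Z is orthogonal to V, and both are
-- orthogonal to F, so α + (z - 1) ≤ |SQ| - dim F = |SQ| - (f - 1) = v - 1 by
-- Euler's formula. Dimensions are compared by counting: an injection from
-- GF(2)^k to GF(2)^m forces k ≤ m.

open import Defs
open import Data.Bool.Base using (Bool; false; true; _xor_; _∧_; not; if_then_else_)
open import Data.Bool.Properties
  using ( xor-assoc; xor-comm; xor-identityʳ; xor-same; ∧-comm; ∧-assoc; ∧-idem; ∧-zeroʳ
        ; ∧-identityʳ; ∧-distribˡ-xor; ∧-distribʳ-xor)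
open import Data.Bool.Solver using (module xor-∧-Solver)
open import Data.Fin.Base using (Fin; zero; suc; finToFun; funToFin; splitAt; combine; fromℕ<)
open import Data.Fin.Permutation using (permutation; ↔⇒≡)
open import Data.Fin.Properties
  using (_≟_; _<?_; <-cmp; injective⇒≤; funToFin-finToFin; finToFun-funToFin; 2↔Bool; join-splitAt; suc-injective)
open import Data.Fin.Subset using (Subset; _∈_; ∣_∣; inside; outside)
open import Data.Integer.Base using (+_; _-_; _≤_)
import Data.Integer.Base as ℤ
import Data.Integer.Properties as ℤ
open import Data.Integer.Solver using () renaming (module +-*-Solver to ℤ-Solver)
open import Data.List.Base using ([]; _∷_)
open import Data.List.Relation.Unary.Any using (here; there)
open import Data.Nat.Base as ℕ using (ℕ; suc; _^_)
open import Data.Nat.Divisibility using (_∣_; divides; divides-refl)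
import Data.Nat.Properties as ℕ
open import Data.Product.Base using (∃-syntax; _×_; _,_; proj₁; proj₂)
open import Data.Sum.Base using (inj₁; inj₂)
open import Data.Vec.Base using ([]; _∷_)
import Data.Vec.Base as Vec
open import Data.Vec.Functional as Vector using (Vector)
open import Function.Base using (_∘_; const)
open import Function.Bundles using (module Inverse; mk⇔)
open import Relation.Binary.Construct.Closure.Equivalence as Eq using ()
open import Relation.Binary.Definitions using (tri<; tri≈; tri>)
open import Relation.Binary.PropositionalEquality
  using (_≡_; _≢_; _≗_; refl; sym; trans; cong; cong₂; subst; isEquivalence; module ≡-Reasoning)
open import Relation.Nullary using (does; yes; no; contradiction; ¬_)
open import Relation.Nullary.Decidable using (dec-true; dec-false; does-⇔)

open xor-∧-Solver using (solve; _:+_; _:*_; _:=_; con)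

-- Linear algebra over GF(2)

private variable
  j k l m n : ℕ

∑ : Vector Bool n → Bool
∑ = GF2.sum

infix 7 _·_

_·_ : Vector Bool m → Vector Bool m → Bool
X · Y = ∑ (λ i → X i ∧ Y i)

kronecker : Fin n → Vector Bool n
kronecker i j = does (i ≟ j)

xor-cancelˡ : ∀ x {y z} → x xor y ≡ x xor z → y ≡ z
xor-cancelˡ x {y} {z} eq = trans (sym (double y)) (trans (cong (x xor_) eq) (double z))
  where
  double : ∀ y → x xor (x xor y) ≡ y
  double y = solve 2 (λ x y → x :+ (x :+ y) := y) refl x y

xor-cancelʳ : ∀ {y z} x → y xor x ≡ z xor x → y ≡ z
xor-cancelʳ {y} {z} x eq = xor-cancelˡ x (trans (xor-comm x y) (trans eq (xor-comm z x)))

xor≡false⇒≡ : ∀ {x y} → x xor y ≡ false → x ≡ y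
xor≡false⇒≡ {x} {y} eq = xor-cancelʳ y (trans eq (sym (xor-same y)))

∑-false : {f : Vector Bool n} → (∀ i → f i ≡ false) → ∑ f ≡ false
∑-false {n = n} f≡false = trans (GF2.sum-cong-≗ f≡false) (GF2.sum-replicate-zero n)

∑-kronecker : (X : Vector Bool n) (i : Fin n) → ∑ (λ j → X j ∧ kronecker i j) ≡ X i
∑-kronecker X zero    = trans (cong₂ _xor_ (∧-identityʳ (X zero)) (∑-false (λ j → ∧-zeroʳ (X (suc j))))) (xor-identityʳ (X zero))
∑-kronecker X (suc i) = cong₂ _xor_ (∧-zeroʳ (X zero)) (∑-kronecker (X ∘ suc) i)

·-comm : (X Y : Vector Bool m) → X · Y ≡ Y · X
·-comm X Y = GF2.sum-cong-≗ (λ i → ∧-comm (X i) (Y i))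

kronecker-· : (i : Fin n) (X : Vector Bool n) → kronecker i · X ≡ X i
kronecker-· i X = trans (·-comm (kronecker i) X) (∑-kronecker X i)

·-congˡ : (Y : Vector Bool m) {X X′ : Vector Bool m} → X ≗ X′ → X · Y ≡ X′ · Y
·-congˡ Y eq = GF2.sum-cong-≗ (λ i → cong (_∧ Y i) (eq i))

·-distribʳ-xor : (Y X X′ : Vector Bool m) → (λ i → X i xor X′ i) · Y ≡ X · Y xor X′ · Y
·-distribʳ-xor Y X X′ =
  trans (GF2.sum-cong-≗ (λ i → ∧-distribʳ-xor (Y i) (X i) (X′ i))) (GF2.∑-distrib-+ (λ i → X i ∧ Y i) _)

combination-· : (X : Vector Bool k) (B : Fin k → Vector Bool m) (Y : Vector Bool m) →
                combination X B · Y ≡ ∑ (λ j → X j ∧ B j · Y)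
combination-· X B Y = begin
  ∑ (λ i → ∑ (λ j → X j ∧ B j i) ∧ Y i)     ≡⟨ GF2.sum-cong-≗ (λ i → GF2.*-distribʳ-sum (Y i) (λ j → X j ∧ B j i)) ⟩
  ∑ (λ i → ∑ (λ j → (X j ∧ B j i) ∧ Y i))   ≡⟨ GF2.∑-comm (λ i j → (X j ∧ B j i) ∧ Y i) ⟩
  ∑ (λ j → ∑ (λ i → (X j ∧ B j i) ∧ Y i))   ≡⟨ GF2.sum-cong-≗ (λ j → trans (GF2.sum-cong-≗ (λ i → ∧-assoc (X j) (B j i) (Y i))) (sym (GF2.*-distribˡ-sum (X j) (λ i → B j i ∧ Y i)))) ⟩
  ∑ (λ j → X j ∧ B j · Y)                   ∎
  where open ≡-Reasoning

combination-⊥ : (X : Vector Bool k) (B : Fin k → Vector Bool m) (Y : Vector Bool m) →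
                (∀ j → B j · Y ≡ false) → combination X B · Y ≡ false
combination-⊥ X B Y ⊥Y =
  trans (combination-· X B Y) (∑-false (λ j → trans (cong (X j ∧_) (⊥Y j)) (∧-zeroʳ (X j))))

combination-dual : (X : Vector Bool k) (B : Fin k → Vector Bool m) (Y : Vector Bool m) (i : Fin k) →
                   (∀ j → B j · Y ≡ kronecker i j) → combination X B · Y ≡ X i
combination-dual X B Y i dual =
  trans (combination-· X B Y) (trans (GF2.sum-cong-≗ (λ j → cong (X j ∧_) (dual j))) (∑-kronecker X i))

combination-cong : {X X′ : Vector Bool k} (B : Fin k → Vector Bool m) → X ≗ X′ → combination X B ≗ combination X′ B
combination-cong B eq i = GF2.sum-cong-≗ (λ j → cong (_∧ B j i) (eq j))

combination-xor : (X X′ : Vector Bool k) (B : Fin k → Vector Bool m) →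
                  ∀ i → combination (λ j → X j xor X′ j) B i ≡ combination X B i xor combination X′ B i
combination-xor X X′ B i = ·-distribʳ-xor (λ j → B j i) X X′

-- Stated for arbitrary end maps so that it serves both as the coboundary of a graph and as `∂` on
-- the squares of a map.
difference : {E : Set} (p q : E → Fin n) → Vector Bool n → E → Bool
difference p q S e = S (p e) xor S (q e)

difference-combination : (p q : Fin m → Fin n) (X : Vector Bool k) (B : Fin k → Vector Bool n) →
                         difference p q (combination X B) ≗ combination X (difference p q ∘ B)
difference-combination p q X B e =
  trans (sym (GF2.∑-distrib-+ (λ j → X j ∧ B j (p e)) _))
        (GF2.sum-cong-≗ (λ j → sym (∧-distribˡ-xor (X j) (B j (p e)) (B j (q e)))))

-- Binary numbering of the vectors turns `F` into an injection from `Fin (2 ^ k)` to `Fin (2 ^ m)`,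
-- which is impossible when `m < k`. Injectivity is up to `≗`, since vectors are functions without
-- extensionality.
injection⇒≤ : (F : Vector Bool k → Vector Bool m) → (∀ X Y → F X ≗ F Y → X ≗ Y) → k ℕ.≤ m
injection⇒≤ {k} {m} F F-inj =
  ℕ.≮⇒≥ (λ m<k → ℕ.<⇒≱ (ℕ.^-monoʳ-< 2 ℕ.≤-refl m<k) (injective⇒≤ {f = code} code-injective))
  where
  open Inverse 2↔Bool using (to; from; strictlyInverseˡ; strictlyInverseʳ)

  bits : ∀ n → Fin (2 ^ n) → Vector Bool n
  bits n i = to ∘ finToFun {2} {n} i

  number : Vector Bool n → Fin (2 ^ n)
  number X = funToFin (from ∘ X)

  bits-number : (X : Vector Bool n) → bits n (number X) ≗ X
  bits-number X i = trans (cong to (finToFun-funToFin (from ∘ X) i)) (strictlyInverseˡ (X i))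

  funToFin-cong : {f g : Fin n → Fin 2} → f ≗ g → funToFin f ≡ funToFin g
  funToFin-cong {n = ℕ.zero} eq = refl
  funToFin-cong {n = suc n}  eq = cong₂ combine (eq zero) (funToFin-cong (eq ∘ suc))

  bits-injective : ∀ n (i j : Fin (2 ^ n)) → bits n i ≗ bits n j → i ≡ j
  bits-injective n i j eq =
    trans (sym (funToFin-finToFin {n} i)) (trans (funToFin-cong same) (funToFin-finToFin {n} j))
    where
    same : finToFun {2} {n} i ≗ finToFun {2} {n} j
    same l = trans (sym (strictlyInverseʳ (finToFun {2} {n} i l)))
      (trans (cong from (eq l)) (strictlyInverseʳ (finToFun {2} {n} j l)))

  code : Fin (2 ^ k) → Fin (2 ^ m)
  code i = number (F (bits k i))

  code-injective : ∀ {i j} → code i ≡ code j → i ≡ j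
  code-injective {i} {j} eq = bits-injective k i j (F-inj _ _ (λ l →
    trans (sym (bits-number (F (bits k i)) l)) (trans (cong (λ c → bits m c l) eq) (bits-number (F (bits k j)) l))))

-- Both bounds encode three families of coefficients at once; here they are the blocks of one
-- vector.
injection₃⇒≤ : (F : Vector Bool j → Vector Bool k → Vector Bool l → Vector Bool m) →
               (∀ X X′ Y Y′ Z Z′ → F X Y Z ≗ F X′ Y′ Z′ → X ≗ X′ × Y ≗ Y′ × Z ≗ Z′) →
               j ℕ.+ (k ℕ.+ l) ℕ.≤ m
injection₃⇒≤ {j} {k} F F-inj = injection⇒≤
  (λ W → F (Vector.take j W) (Vector.take k (Vector.drop j W)) (Vector.drop k (Vector.drop j W)))
  λ W W′ eq → let (X≗ , Y≗ , Z≗) = F-inj _ _ _ _ _ _ eq in split-≗ j X≗ (split-≗ k Y≗ Z≗)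
  where
  split-≗ : ∀ m {n} {W W′ : Vector Bool (m ℕ.+ n)} →
            Vector.take m W ≗ Vector.take m W′ → Vector.drop m W ≗ Vector.drop m W′ → W ≗ W′
  split-≗ m {n} eqˡ eqʳ i with splitAt m i | join-splitAt m n i
  ... | inj₁ i′ | refl = eqˡ i′
  ... | inj₂ i′ | refl = eqʳ i′

-- Stars of vertices

odd : ℕ → Bool
odd ℕ.zero  = false
odd (suc n) = not (odd n)

odd-+ : ∀ m n → odd (m ℕ.+ n) ≡ odd m xor odd n
odd-+ ℕ.zero  n = refl
odd-+ (suc m) n = trans (cong not (odd-+ m n)) (sym (xor-assoc true (odd m) (odd n)))

odd-sum : (f : Vector ℕ n) → odd (NatSum.sum f) ≡ ∑ (odd ∘ f)
odd-sum {ℕ.zero} f = refl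
odd-sum {suc n}  f = trans (odd-+ (f zero) _) (cong (odd (f zero) xor_) (odd-sum (f ∘ suc)))

even⇒2∣ : ∀ n → odd n ≡ false → 2 ∣ n
even⇒2∣ ℕ.zero          _  = divides-refl 0
even⇒2∣ (suc (suc n)) eq with even⇒2∣ n (trans (sym (solve 1 (λ x → con true :+ (con true :+ x) := x) refl (odd n))) eq)
... | divides q refl = divides-refl (suc q)

2∣⇒even : ∀ {n} → 2 ∣ n → odd n ≡ false
2∣⇒even (divides ℕ.zero    refl) = refl
2∣⇒even (divides (suc q) refl) = trans (solve 1 (λ x → con true :+ (con true :+ x) := x) refl (odd (q ℕ.* 2))) (2∣⇒even (divides-refl q))

module _ (G : Graph) where
  open Graph G using (end₁; end₂; degreeIn; degree; incidence; Adjacent; Independent)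

  coboundary : Vector Bool (#V G) → Vector Bool (#E G)
  coboundary = difference end₁ end₂

  star : Fin (#V G) → Vector Bool (#E G)
  star u = coboundary (kronecker u)

  -- A loop counts 2 in `incidence` and cancels in the star. The two sides test equality in opposite
  -- directions, so the last four clauses discard decisions that disagree.
  odd-incidence : ∀ u e → odd (incidence u e) ≡ star u e
  odd-incidence u e with end₁ e ≟ u | end₂ e ≟ u | u ≟ end₁ e | u ≟ end₂ e
  ... | yes _ | yes _ | yes _ | yes _ = refl
  ... | yes _ | no _  | yes _ | no _  = refl
  ... | no _  | yes _ | no _  | yes _ = refl
  ... | no _  | no _  | no _  | no _  = refl
  ... | yes p | _ | no q | _ = contradiction (sym p) q
  ... | no p | _ | yes q | _ = contradiction (sym q) p
  ... | _ | yes p | _ | no q = contradiction (sym p) q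
  ... | _ | no p | _ | yes q = contradiction (sym q) p

  -- The bridge from degrees to scalar products: even degrees become orthogonality to stars, and odd
  -- degrees become stars of norm one.
  odd-degreeIn : ∀ X u → odd (degreeIn X u) ≡ X · star u
  odd-degreeIn X u = trans (odd-sum (λ e → if X e then incidence u e else 0)) (GF2.sum-cong-≗ step)
    where
    step : ∀ e → odd (if X e then incidence u e else 0) ≡ X e ∧ star u e
    step e with X e
    ... | true  = odd-incidence u e
    ... | false = refl

  cycle⊥star : ∀ {X} → Cycle G X → ∀ u → X · star u ≡ false
  cycle⊥star {X} cycle u = trans (sym (odd-degreeIn X u)) (2∣⇒even (cycle u))

  star·star-self : AllDegreesOdd G → ∀ u → star u · star u ≡ true
  star·star-self odd-degrees u =
    trans (GF2.sum-cong-≗ (λ e → ∧-idem (star u e))) (trans (sym (odd-degreeIn (const true) u)) degree-odd)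
    where
    degree-odd : odd (degree u) ≡ true
    degree-odd with odd (degree u) in eq
    ... | true  = refl
    ... | false = contradiction (even⇒2∣ _ eq) (odd-degrees u)

  -- An edge in both stars would have one end at `u` and the other at `w`.
  star·star-nonadjacent : ∀ u w → u ≢ w → ¬ Adjacent u w → star u · star w ≡ false
  star·star-nonadjacent u w u≢w nonadj = ∑-false disjoint
    where
    disjoint : ∀ e → star u e ∧ star w e ≡ false
    disjoint e with u ≟ end₁ e | u ≟ end₂ e | w ≟ end₁ e | w ≟ end₂ e
    ... | no _ | no _ | _ | _ = refl
    ... | yes _ | yes _ | _ | _ = refl
    ... | yes p | no _ | yes q | _ = contradiction (trans p (sym q)) u≢w
    ... | yes p | no _ | no _ | yes q = contradiction (e , inj₁ (sym p , sym q)) nonadj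
    ... | yes _ | no _ | no _ | no _ = refl
    ... | no _ | yes p | _ | yes q = contradiction (trans p (sym q)) u≢w
    ... | no _ | yes p | yes q | no _ = contradiction (e , inj₂ (sym q , sym p)) nonadj
    ... | no _ | yes _ | no _ | no _ = refl

-- Listing the elements of a subset

enumerate : (S : Subset n) → Fin ∣ S ∣ → Fin n
enumerate (inside  ∷ S) zero    = zero
enumerate (inside  ∷ S) (suc i) = suc (enumerate S i)
enumerate (outside ∷ S) i       = suc (enumerate S i)

enumerate-∈ : (S : Subset n) (i : Fin ∣ S ∣) → enumerate S i ∈ S
enumerate-∈ (inside  ∷ S) zero    = Vec.here
enumerate-∈ (inside  ∷ S) (suc i) = Vec.there (enumerate-∈ S i)
enumerate-∈ (outside ∷ S) i       = Vec.there (enumerate-∈ S i)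

enumerate-injective : (S : Subset n) {i j : Fin ∣ S ∣} → enumerate S i ≡ enumerate S j → i ≡ j
enumerate-injective (inside  ∷ S) {zero}  {zero}  eq = refl
enumerate-injective (inside  ∷ S) {suc i} {suc j} eq = cong suc (enumerate-injective S (suc-injective eq))
enumerate-injective (outside ∷ S) eq = enumerate-injective S (suc-injective eq)

-- Orthogonality of the three coboundary spaces of a map

-- A function on the cycles of two matchings is handled as a function on `Fin n` invariant under
-- both. Elements of V, F and Z then all live on the squares of one map, without renumbering.
Invariant : Matching n → (Fin n → Bool) → Set
Invariant m T = ∀ x → T (mate m x) ≡ T x

∑-mate : (m : Matching n) (T : Vector Bool n) → ∑ (T ∘ mate m) ≡ ∑ T
∑-mate m T = sym (GF2.sum-permute T (permutation (mate m) (mate m) (mate-involutive m) (mate-involutive m)))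

-- The two vertices of a matched pair contribute equal terms, which cancel. `half` keeps only the
-- term at the smaller vertex of each pair.
∑-invariant : (m : Matching n) {T : Vector Bool n} → Invariant m T → ∑ T ≡ false
∑-invariant m {T} inv = begin
  ∑ T                                                      ≡⟨ GF2.sum-cong-≗ split ⟩
  ∑ (λ x → half x xor half (mate m x))                     ≡⟨ GF2.∑-distrib-+ half (half ∘ mate m) ⟩
  ∑ half xor ∑ (half ∘ mate m)                             ≡⟨ cong (∑ half xor_) (∑-mate m half) ⟩
  ∑ half xor ∑ half                                        ≡⟨ xor-same (∑ half) ⟩
  false                                                    ∎
  where
  open ≡-Reasoning
  half : Fin _ → Bool
  half x = T x ∧ does (x <? mate m x)

  -- Exactly one vertex of a pair is the smaller, because `mate m` has no fixed point.
  lower : ∀ x → does (x <? mate m x) xor does (mate m x <? mate m (mate m x)) ≡ true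
  lower x rewrite mate-involutive m x with <-cmp x (mate m x)
  ... | tri< x<y _ y≮x = cong₂ _xor_ (dec-true (x <? mate m x) x<y) (dec-false (mate m x <? x) y≮x)
  ... | tri≈ _ x≡y _   = contradiction (sym x≡y) (mate-≢ m x)
  ... | tri> x≮y _ y<x = cong₂ _xor_ (dec-false (x <? mate m x) x≮y) (dec-true (mate m x <? x) y<x)

  split : ∀ x → T x ≡ half x xor half (mate m x)
  split x = sym (trans (cong (λ t → half x xor (t ∧ does (mate m x <? mate m (mate m x)))) (inv x))
    (trans (sym (∧-distribˡ-xor (T x) (does (x <? mate m x)) (does (mate m x <? mate m (mate m x)))))
    (trans (cong (T x ∧_) (lower x)) (∧-identityʳ (T x)))))

module MapSpaces (M : Map n) where
  open Map M hiding (#SQ)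

  v-f-comm : ∀ x → mate v (mate f x) ≡ mate f (mate v x)
  v-f-comm x = trans (cong (mate v ∘ mate f) (sym (mate-involutive v x)))
    (trans (sym (mate-involutive f (mate v (mate f (mate v (mate v x))))))
    (cong (mate f) (squares (mate v x))))

  -- The sum of `T` over the vertices of the square through `x`.
  four : (Fin n → Bool) → Fin n → Bool
  four T x = T x xor (T (mate v x) xor (T (mate f x) xor T (mate f (mate v x))))

  -- Allows a quantity defined at the representative of a square to be computed at any of its
  -- vertices.
  class-rep-invariant : {A : Set} {h : Fin n → A} → (∀ x → h (mate v x) ≡ h x) → (∀ x → h (mate f x) ≡ h x) →
                        ∀ {x s} → class SQ x ≡ s → h (rep SQ s) ≡ h x
  class-rep-invariant {h = h} v-inv f-inv {x} {s} x∈s =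
    Eq.gfold isEquivalence h step (complete SQ (trans (class-rep SQ s) (sym x∈s)))
    where
    step : ∀ {x y} → Step (v ∷ f ∷ []) x y → h x ≡ h y
    step (here refl)         = sym (v-inv _)
    step (there (here refl)) = sym (f-inv _)

  class-v : ∀ x → class SQ (mate v x) ≡ class SQ x
  class-v x = sym (sound SQ (Eq.return (here refl)))

  class-f : ∀ x → class SQ (mate f x) ≡ class SQ x
  class-f x = sym (sound SQ (Eq.return (there (here refl))))

  -- The four vertices of a square are distinct, so its indicator is the sum of theirs. For `x` in
  -- the square, the sum `N` is invariant under `v` and `f` and can be evaluated at the
  -- representative, where only the first term survives. For other `x` every term vanishes.
  kronecker-class : ∀ s x → kronecker (class SQ x) s ≡ four (λ y → kronecker y x) (rep SQ s)
  kronecker-class s x with class SQ x ≟ s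
  ... | yes x∈s = sym (trans (sym (class-rep-invariant N-v N-f x∈s)) N-rep)
    where
    r = rep SQ s

    N : Fin n → Bool
    N x = four (λ y → kronecker y x) r

    -- Moving the involution to the other argument shows that `v` and `f` merely permute the four
    -- terms of `N`.
    move : (m : Matching n) → ∀ y x → kronecker y (mate m x) ≡ kronecker (mate m y) x
    move m y x = does-⇔ (mk⇔ (λ { refl → mate-involutive m x }) (λ { refl → sym (mate-involutive m y) }))
                        (y ≟ mate m x) (mate m y ≟ x)

    N-v : ∀ x → N (mate v x) ≡ N x
    N-v x rewrite move v r x | move v (mate v r) x | move v (mate f r) x | move v (mate f (mate v r)) x
                | mate-involutive v r | v-f-comm (mate v r) | mate-involutive v r | v-f-comm r =
      solve 4 (λ p q s t → q :+ (p :+ (t :+ s)) := p :+ (q :+ (s :+ t))) refl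
        (kronecker r x) (kronecker (mate v r) x) (kronecker (mate f r) x) (kronecker (mate f (mate v r)) x)

    N-f : ∀ x → N (mate f x) ≡ N x
    N-f x rewrite move f r x | move f (mate v r) x | move f (mate f r) x | move f (mate f (mate v r)) x
                | mate-involutive f r | mate-involutive f (mate v r) =
      solve 4 (λ p q s t → s :+ (t :+ (p :+ q)) := p :+ (q :+ (s :+ t))) refl
        (kronecker r x) (kronecker (mate v r) x) (kronecker (mate f r) x) (kronecker (mate f (mate v r)) x)

    N-rep : N r ≡ true
    N-rep = cong₂ _xor_ (dec-true (r ≟ r) refl)
      (cong₂ _xor_ (dec-false (mate v r ≟ r) (mate-≢ v r))
      (cong₂ _xor_ (dec-false (mate f r ≟ r) (mate-≢ f r)) (dec-false (mate z r ≟ r) (mate-≢ z r))))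
  ... | no x∉s = sym (cong₂ _xor_ (off r refl)
      (cong₂ _xor_ (off (mate v r) (class-v r))
      (cong₂ _xor_ (off (mate f r) (class-f r)) (off (mate z r) (trans (class-f (mate v r)) (class-v r))))))
    where
    r = rep SQ s

    off : ∀ y → class SQ y ≡ class SQ r → kronecker y x ≡ false
    off y y~r = dec-false (y ≟ x) (λ { refl → x∉s (trans y~r (class-rep SQ s)) })

  -- Each vertex lies in exactly one square: insert its indicator and exchange the two sums.
  ∑-squares : (T : Vector Bool n) → ∑ T ≡ ∑ (λ s → four T (rep SQ s))
  ∑-squares T = begin
    ∑ T                                                    ≡⟨ GF2.sum-cong-≗ (λ x → ∑-kronecker (const (T x)) (class SQ x)) ⟨
    ∑ (λ x → ∑ (λ s → T x ∧ kronecker (class SQ x) s))     ≡⟨ GF2.∑-comm (λ x s → T x ∧ kronecker (class SQ x) s) ⟩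
    ∑ (λ s → ∑ (λ x → T x ∧ kronecker (class SQ x) s))     ≡⟨ GF2.sum-cong-≗ collect ⟩
    ∑ (λ s → four T (rep SQ s))                            ∎
    where
    open ≡-Reasoning
    collect : ∀ s → ∑ (λ x → T x ∧ kronecker (class SQ x) s) ≡ four T (rep SQ s)
    collect s = begin
      ∑ (λ x → T x ∧ kronecker (class SQ x) s)                     ≡⟨ GF2.sum-cong-≗ (λ x → trans (cong (T x ∧_) (kronecker-class s x)) (∧-comm (T x) _)) ⟩
      (λ x → K r x xor (K rv x xor (K rf x xor K rz x))) · T       ≡⟨ ·-distribʳ-xor T (K r) (λ x → K rv x xor (K rf x xor K rz x)) ⟩
      K r · T xor (λ x → K rv x xor (K rf x xor K rz x)) · T       ≡⟨ cong (K r · T xor_) (·-distribʳ-xor T (K rv) (λ x → K rf x xor K rz x)) ⟩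
      K r · T xor (K rv · T xor (λ x → K rf x xor K rz x) · T)     ≡⟨ cong (λ t → K r · T xor (K rv · T xor t)) (·-distribʳ-xor T (K rf) (K rz)) ⟩
      K r · T xor (K rv · T xor (K rf · T xor K rz · T))           ≡⟨ cong₂ _xor_ (pick r) (cong₂ _xor_ (pick rv) (cong₂ _xor_ (pick rf) (pick rz))) ⟩
      four T r                                                     ∎
      where
      K : Fin n → Vector Bool n
      K = kronecker
      r  = rep SQ s
      rv = mate v r
      rf = mate f r
      rz = mate f (mate v r)

      pick : ∀ y → K y · T ≡ T y
      pick y = kronecker-· y T

  -- For `a`-invariant `T`, `∂ f T` is in V if `T` is `v`-invariant, and `∂ v T` is in F or Z if `T`
  -- is `f`- or `z`-invariant. In the last case `v` and `f` give the same difference, by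
  -- `z-invariant⇒f≡v`.
  ∂ : Matching n → (Fin n → Bool) → Vector Bool (#SQ M)
  ∂ m = difference (rep SQ) (mate m ∘ rep SQ)

  z-invariant⇒f≡v : ∀ {T} → Invariant z T → ∀ x → T (mate f x) ≡ T (mate v x)
  z-invariant⇒f≡v {T} T-z x = trans (cong (T ∘ mate f) (sym (mate-involutive v x))) (T-z (mate v x))

  module _ {T U : Fin n → Bool} (T-a : Invariant a T) (U-a : Invariant a U) where

    private
      -- If each square contributes the sum of `T x ∧ U x` over its vertices, the total runs over
      -- all vertices and cancels along the edges of `a`.
      ⊥-criterion : ∀ X Y → (∀ s → X s ∧ Y s ≡ four (λ x → T x ∧ U x) (rep SQ s)) → X · Y ≡ false
      ⊥-criterion X Y eq = trans (GF2.sum-cong-≗ eq) (trans (sym (∑-squares (λ x → T x ∧ U x)))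
        (∑-invariant a (λ x → cong₂ _∧_ (T-a x) (U-a x))))

    -- On a square `T` has one value on each `v`-edge and `U` one on each `f`-edge. Every `v`-edge
    -- meets every `f`-edge in one vertex, so the product of the two differences expands into the
    -- four vertex terms. Likewise for any two of `v`, `f`, `z` in the next two lemmas.
    V⊥F : Invariant v T → Invariant f U → ∂ f T · ∂ v U ≡ false
    V⊥F T-v U-f = ⊥-criterion (∂ f T) (∂ v U) λ s → expand (rep SQ s)
      where
      expand : ∀ r → (T r xor T (mate f r)) ∧ (U r xor U (mate v r)) ≡ four (λ x → T x ∧ U x) r
      expand r rewrite sym (v-f-comm r) | T-v (mate f r) | T-v r | v-f-comm r | U-f (mate v r) | U-f r =
        solve 4 (λ t t′ u u′ → (t :+ t′) :* (u :+ u′) := t :* u :+ (t :* u′ :+ (t′ :* u :+ t′ :* u′))) refl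
          (T r) (T (mate f r)) (U r) (U (mate v r))

    Z⊥F : Invariant z T → Invariant f U → ∂ v T · ∂ v U ≡ false
    Z⊥F T-z U-f = ⊥-criterion (∂ v T) (∂ v U) λ s → expand (rep SQ s)
      where
      expand : ∀ r → (T r xor T (mate v r)) ∧ (U r xor U (mate v r)) ≡ four (λ x → T x ∧ U x) r
      expand r rewrite T-z r | z-invariant⇒f≡v T-z r | U-f (mate v r) | U-f r =
        solve 4 (λ t t′ u u′ → (t :+ t′) :* (u :+ u′) := t :* u :+ (t′ :* u′ :+ (t′ :* u :+ t :* u′))) refl
          (T r) (T (mate v r)) (U r) (U (mate v r))

    Z⊥V : Invariant z T → Invariant v U → ∂ v T · ∂ f U ≡ false
    Z⊥V T-z U-v = ⊥-criterion (∂ v T) (∂ f U) λ s → expand (rep SQ s)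
      where
      expand : ∀ r → (T r xor T (mate v r)) ∧ (U r xor U (mate f r)) ≡ four (λ x → T x ∧ U x) r
      expand r rewrite T-z r | z-invariant⇒f≡v T-z r | sym (v-f-comm r) | U-v (mate f r) | U-v r =
        solve 4 (λ t t′ u u′ → (t :+ t′) :* (u :+ u′) := t :* u :+ (t′ :* u :+ (t′ :* u′ :+ t :* u′))) refl
          (T r) (T (mate v r)) (U r) (U (mate f r))

  ∂v-class-f : ∀ {T} → Invariant f T → ∀ x → ∂ v T (class SQ x) ≡ T x xor T (mate v x)
  ∂v-class-f {T} T-f x = class-rep-invariant {h = λ x → T x xor T (mate v x)}
    (λ x → trans (cong (λ y → T (mate v x) xor T y) (mate-involutive v x)) (xor-comm (T (mate v x)) (T x)))
    (λ x → cong₂ _xor_ (T-f x) (trans (cong T (v-f-comm x)) (T-f (mate v x))))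
    refl

  ∂v-class-z : ∀ {T} → Invariant z T → ∀ x → ∂ v T (class SQ x) ≡ T x xor T (mate v x)
  ∂v-class-z {T} T-z x = class-rep-invariant {h = λ x → T x xor T (mate v x)}
    (λ x → trans (cong (λ y → T (mate v x) xor T y) (mate-involutive v x)) (xor-comm (T (mate v x)) (T x)))
    (λ x → trans (cong₂ _xor_ (z-invariant⇒f≡v T-z x) (trans (cong T (v-f-comm x)) (T-z x))) (xor-comm (T (mate v x)) (T x)))
    refl

  -- A walk from x to y crosses squares; those it crosses along a v-edge form a
  -- path from the face of x to the face of y in the graph of the dual map.
  DualPath : Fin n → Fin n → Set
  DualPath x y = ∃[ P ] ∀ U → Invariant f U → Invariant a U → P · ∂ v U ≡ U x xor U y

  dualPath : ∀ {x y} → SameComponent (v ∷ f ∷ a ∷ []) x y → DualPath x y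
  dualPath = Eq.fold (record { refl = refl′ ; sym = sym′ ; trans = trans′ }) step
    where
    refl′ : ∀ {x} → DualPath x x
    refl′ {x} = const false , λ U _ _ → trans (∑-false {f = const false ∘ ∂ v U} (λ _ → refl)) (sym (xor-same (U x)))

    sym′ : ∀ {x y} → DualPath x y → DualPath y x
    sym′ {x} {y} (P , p) = P , λ U U-f U-a → trans (p U U-f U-a) (xor-comm (U x) (U y))

    trans′ : ∀ {x y w} → DualPath x y → DualPath y w → DualPath x w
    trans′ {x} {y} {w} (P , p) (Q , q) = (λ s → P s xor Q s) , λ U U-f U-a →
      trans (·-distribʳ-xor (∂ v U) P Q) (trans (cong₂ _xor_ (p U U-f U-a) (q U U-f U-a))
        (solve 3 (λ x y w → (x :+ y) :+ (y :+ w) := x :+ w) refl (U x) (U y) (U w)))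

    step : ∀ {x y} → Step (v ∷ f ∷ a ∷ []) x y → DualPath x y
    step {x} (here refl) = kronecker (class SQ x) , λ U U-f _ → trans (kronecker-· (class SQ x) (∂ v U)) (∂v-class-f U-f x)
    -- An `f`- or `a`-step stays on one face, so the empty set of squares serves.
    step {x} (there (here refl)) = proj₁ (refl′ {x}) , λ U U-f U-a →
      trans (proj₂ (refl′ {x}) U U-f U-a) (cong (U x xor_) (sym (U-f x)))
    step {x} (there (there (here refl))) = proj₁ (refl′ {x}) , λ U U-f U-a →
      trans (proj₂ (refl′ {x}) U U-f U-a) (cong (U x xor_) (sym (U-a x)))

  ∂v-injective : ∀ {T T′} → Invariant z T → Invariant a T → Invariant z T′ → Invariant a T′ →
                 ∂ v T ≗ ∂ v T′ → ∀ {x y} → SameComponent (v ∷ f ∷ a ∷ []) x y → T x ≡ T′ x → T y ≡ T′ y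
  ∂v-injective {T} {T′} T-z T-a T′-z T′-a eq {x} {y} x~y Tx≡T′x = xor≡false⇒≡ (trans
    (sym (Eq.gfold isEquivalence (λ x → T x xor T′ x) step x~y)) (trans (cong (_xor T′ x) Tx≡T′x) (xor-same (T′ x))))
    where
    v-step : ∀ x → T x xor T′ x ≡ T (mate v x) xor T′ (mate v x)
    v-step x = xor-cancelˡ (T (mate v x) xor T′ x) (trans
      (solve 3 (λ t t″ t′ → (t″ :+ t′) :+ (t :+ t′) := t :+ t″) refl (T x) (T (mate v x)) (T′ x))
      (trans (trans (sym (∂v-class-z T-z x)) (trans (eq (class SQ x)) (∂v-class-z T′-z x)))
      (solve 3 (λ t″ t′ t‴ → t′ :+ t‴ := (t″ :+ t′) :+ (t″ :+ t‴)) refl (T (mate v x)) (T′ x) (T′ (mate v x)))))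

    step : ∀ {x y} → Step (v ∷ f ∷ a ∷ []) x y → T x xor T′ x ≡ T y xor T′ y
    step {x} (here refl) = v-step x
    step {x} (there (here refl)) = trans (v-step x) (sym (cong₂ _xor_ (z-invariant⇒f≡v T-z x) (z-invariant⇒f≡v T′-z x)))
    step {x} (there (there (here refl))) = sym (cong₂ _xor_ (T-a x) (T′-a x))

  constant-on-cycles : (m : Matching n) (S : Fin (#classes (cycles m a)) → Bool) →
                       Invariant m (S ∘ class (cycles m a)) × Invariant a (S ∘ class (cycles m a))
  constant-on-cycles m S =
    (λ x → cong S (sym (sound (cycles m a) (Eq.return (here refl))))) ,
    (λ x → cong S (sym (sound (cycles m a) (Eq.return (there (here refl))))))

  -- Stars and zigzag coboundaries are orthogonal to F. Dual paths from a base face to every face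
  -- are added as vectors that F detects, so that all three families of coefficients can be
  -- recovered from one set of squares and two extra bits.
  orthonormal-bound : C-Connected M → (B : Fin k → Vector Bool (#V (graph M))) →
                      (∀ i j → coboundary (graph M) (B j) · coboundary (graph M) (B i) ≡ kronecker i j) →
                      k ℕ.+ (#zigzags M ℕ.+ #classes (cycles f a)) ℕ.≤ 2 ℕ.+ #SQ M
  orthonormal-bound {k = k} (0<n , connected) B orthonormal = injection₃⇒≤ encode injective
    where
    x₀ : Fin n
    x₀ = fromℕ< 0<n

    face : Fin n → Fin (#classes (cycles f a))
    face = class (cycles f a)

    zigzag : Fin n → Fin (#zigzags M)
    zigzag = class (cycles z a)

    stars : Fin k → Vector Bool (#SQ M)
    stars i = coboundary (graph M) (B i)

    path : Fin (#classes (cycles f a)) → Vector Bool (#SQ M)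
    path j = proj₁ (dualPath (connected x₀ (rep (cycles f a) j)))

    squaresOf : Vector Bool k → Vector Bool (#zigzags M) → Vector Bool (#classes (cycles f a)) → Vector Bool (#SQ M)
    squaresOf X Y W s = combination X stars s xor (∂ v (Y ∘ zigzag) s xor combination W path s)

    -- The first two bits make up for the one relation that the coboundaries of all
    -- zigzags, respectively of all faces, satisfy.
    encode : Vector Bool k → Vector Bool (#zigzags M) → Vector Bool (#classes (cycles f a)) → Vector Bool (2 ℕ.+ #SQ M)
    encode X Y W = Y (zigzag x₀) Vector.∷ ∑ W Vector.∷ squaresOf X Y W

    squaresOf-· : ∀ X Y W Q → squaresOf X Y W · Q ≡ combination X stars · Q xor (∂ v (Y ∘ zigzag) · Q xor combination W path · Q)
    squaresOf-· X Y W Q = trans (·-distribʳ-xor Q (combination X stars) (λ s → ∂ v (Y ∘ zigzag) s xor combination W path s))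
      (cong (combination X stars · Q xor_) (·-distribʳ-xor Q (∂ v (Y ∘ zigzag)) (combination W path)))

    face-star : Fin (#classes (cycles f a)) → Vector Bool (#SQ M)
    face-star j = ∂ v (kronecker j ∘ face)

    -- A path meets the star of a face in an odd number of squares exactly when one, and only one,
    -- of its ends is that face.
    path·face-star : ∀ i j → path j · face-star i ≡ kronecker i (face x₀) xor kronecker i j
    path·face-star i j = trans (proj₂ (dualPath (connected x₀ (rep (cycles f a) j))) (kronecker i ∘ face) (proj₁ inv) (proj₂ inv))
      (cong (λ c → kronecker i (face x₀) xor kronecker i c) (class-rep (cycles f a) j))
      where inv = constant-on-cycles f (kronecker i)

    -- Only the paths contribute, the other two parts being orthogonal to F. All paths start at
    -- `face x₀`, which therefore collects `∑ W`.
    face-coefficient : ∀ X Y W i → squaresOf X Y W · face-star i ≡ (∑ W ∧ kronecker i (face x₀)) xor W i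
    face-coefficient X Y W i = trans (squaresOf-· X Y W (face-star i))
      (cong₂ _xor_ (combination-⊥ X stars (face-star i) (λ j → V⊥F (proj₂ (va j)) (proj₂ fa) (proj₁ (va j)) (proj₁ fa)))
      (cong₂ _xor_ (Z⊥F (proj₂ za) (proj₂ fa) (proj₁ za) (proj₁ fa)) paths))
      where
      va = λ j → constant-on-cycles v (B j)
      fa = constant-on-cycles f (kronecker i)
      za = constant-on-cycles z Y
      open ≡-Reasoning

      paths : combination W path · face-star i ≡ (∑ W ∧ kronecker i (face x₀)) xor W i
      paths = begin
        combination W path · face-star i                                          ≡⟨ combination-· W path (face-star i) ⟩
        ∑ (λ j → W j ∧ path j · face-star i)                                      ≡⟨ GF2.sum-cong-≗ (λ j → trans (cong (W j ∧_) (path·face-star i j)) (∧-distribˡ-xor (W j) _ _)) ⟩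
        ∑ (λ j → (W j ∧ kronecker i (face x₀)) xor (W j ∧ kronecker i j))         ≡⟨ GF2.∑-distrib-+ (λ j → W j ∧ kronecker i (face x₀)) _ ⟩
        ∑ (λ j → W j ∧ kronecker i (face x₀)) xor ∑ (λ j → W j ∧ kronecker i j)   ≡⟨ cong₂ _xor_ (sym (GF2.*-distribʳ-sum (kronecker i (face x₀)) W)) (∑-kronecker W i) ⟩
        (∑ W ∧ kronecker i (face x₀)) xor W i                                     ∎

    -- The zigzag part drops out because Z is orthogonal to V. The path part remains, but depends on
    -- `W` alone.
    star-coefficient : ∀ X Y W i → squaresOf X Y W · stars i ≡ X i xor combination W path · stars i
    star-coefficient X Y W i = trans (squaresOf-· X Y W (stars i))
      (cong₂ _xor_ (combination-dual X stars (stars i) i (orthonormal i))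
        (cong (_xor combination W path · stars i) (Z⊥V (proj₂ za) (proj₂ va) (proj₁ za) (proj₁ va))))
      where
      va = constant-on-cycles v (B i)
      za = constant-on-cycles z Y

    injective : ∀ X X′ Y Y′ W W′ → encode X Y W ≗ encode X′ Y′ W′ → X ≗ X′ × Y ≗ Y′ × W ≗ W′
    injective X X′ Y Y′ W W′ eq = X≗ , Y≗ , W≗
      where
      eq′ : squaresOf X Y W ≗ squaresOf X′ Y′ W′
      eq′ s = eq (suc (suc s))

      -- The order matters: `W` first, with the stored bit `∑ W` cancelling the excess at the base
      -- face; then `X`, once the path terms agree; then `Y` from what is left.
      W≗ : W ≗ W′
      W≗ i = xor-cancelˡ (∑ W ∧ kronecker i (face x₀)) (trans (sym (face-coefficient X Y W i))
        (trans (·-congˡ (face-star i) eq′) (trans (face-coefficient X′ Y′ W′ i)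
        (cong (λ t → (t ∧ kronecker i (face x₀)) xor W′ i) (sym (eq (suc zero)))))))

      X≗ : X ≗ X′
      X≗ i = xor-cancelʳ (combination W path · stars i) (trans (sym (star-coefficient X Y W i))
        (trans (·-congˡ (stars i) eq′) (trans (star-coefficient X′ Y′ W′ i)
        (cong (X′ i xor_) (sym (·-congˡ (stars i) (combination-cong path W≗)))))))

      zigzag-part : ∂ v (Y ∘ zigzag) ≗ ∂ v (Y′ ∘ zigzag)
      zigzag-part s = xor-cancelʳ (combination W path s) (xor-cancelˡ (combination X stars s) (trans (eq′ s)
        (sym (cong₂ (λ x w → x xor (∂ v (Y′ ∘ zigzag) s xor w)) (combination-cong stars X≗ s) (combination-cong path W≗ s)))))

      Y≗ : Y ≗ Y′
      Y≗ c = trans (sym (cong Y (class-rep (cycles z a) c))) (trans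
        -- The stored bit `Y (zigzag x₀)` fixes the constant that `∂ v` cannot see.
        (∂v-injective (proj₁ za) (proj₂ za) (proj₁ za′) (proj₂ za′) zigzag-part (connected x₀ (rep (cycles z a) c)) (eq zero))
        (cong Y′ (class-rep (cycles z a) c)))
        where
        za = constant-on-cycles z Y
        za′ = constant-on-cycles z Y′

-- Coboundaries under graph isomorphism

module _ {G H : Graph} (G≅H : G ≅ H) where
  open _≅_ G≅H
  open Inverse onV using () renaming (from to fromV; strictlyInverseʳ to fromV-onV)
  open Inverse onE using () renaming (to to toE)

  coboundary-≅ : ∀ S e → coboundary H (S ∘ fromV) (toE e) ≡ coboundary G S e
  coboundary-≅ S e with joins e
  ... | inj₁ (p , q) = cong₂ (λ x y → S x xor S y) (trans (cong fromV p) (fromV-onV _)) (trans (cong fromV q) (fromV-onV _))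
  ... | inj₂ (p , q) = trans
    (cong₂ (λ x y → S x xor S y) (trans (cong fromV p) (fromV-onV _)) (trans (cong fromV q) (fromV-onV _)))
    (xor-comm (S (Graph.end₂ G e)) (S (Graph.end₁ G e)))

  coboundary-·-≅ : ∀ S T → coboundary H (S ∘ fromV) · coboundary H (T ∘ fromV) ≡ coboundary G S · coboundary G T
  coboundary-·-≅ S T = trans (GF2.sum-permute (λ e → coboundary H (S ∘ fromV) e ∧ coboundary H (T ∘ fromV) e) onE)
    (GF2.sum-cong-≗ (λ e → cong₂ _∧_ (coboundary-≅ S e) (coboundary-≅ T e)))

-- The two bounds

module _ (G : Graph) (odd-degrees : AllDegreesOdd G) (S : Subset (#V G)) (indep : Graph.Independent G S) where

  stars-orthonormal : ∀ i j → star G (enumerate S j) · star G (enumerate S i) ≡ kronecker i j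
  stars-orthonormal i j with i ≟ j
  ... | yes refl = star·star-self G odd-degrees (enumerate S i)
  ... | no i≢j   = star·star-nonadjacent G _ _ j≢i (indep _ _ (enumerate-∈ S j) (enumerate-∈ S i) j≢i)
    where
    j≢i : enumerate S j ≢ enumerate S i
    j≢i = i≢j ∘ sym ∘ enumerate-injective S

  -- The encoding takes values in vertex sets, where the set of all vertices, having zero
  -- coboundary, accounts for the extra 1. Bicycles are cycles, hence orthogonal to stars, so
  -- pairing with stars recovers `X`; independence of the basis recovers `Y`, and a look at one
  -- vertex recovers the last bit.
  bicycle-bound : 0 ℕ.< #V G → ∀ {γ} → HasDimension (Bicycle G) γ → ∣ S ∣ ℕ.+ (γ ℕ.+ 1) ℕ.≤ #V G
  bicycle-bound 0<v {γ} dim = injection₃⇒≤ sum-of injective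
    where
    open HasDimension dim
    open Graph G using (end₁; end₂)

    -- A vertex set with coboundary `basis j`.
    side : Fin γ → Vector Bool (#V G)
    side j = proj₁ (proj₂ (basis∈ j))

    chosen : Fin ∣ S ∣ → Vector Bool (#V G)
    chosen = kronecker ∘ enumerate S

    sum-of : Vector Bool ∣ S ∣ → Vector Bool γ → Vector Bool 1 → Vector Bool (#V G)
    sum-of X Y t u = combination X chosen u xor (combination Y side u xor t zero)

    -- The constant `t zero` occurs at both ends of `e` and cancels.
    coboundary-sum-of : ∀ X Y t e →
      coboundary G (sum-of X Y t) e ≡ combination X (star G ∘ enumerate S) e xor combination Y basis e
    coboundary-sum-of X Y t e = trans
      (solve 5 (λ x x′ y y′ t → (x :+ (y :+ t)) :+ (x′ :+ (y′ :+ t)) := (x :+ x′) :+ (y :+ y′)) refl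
        (combination X chosen (end₁ e)) (combination X chosen (end₂ e)) (combination Y side (end₁ e)) (combination Y side (end₂ e)) (t zero))
      (cong₂ _xor_ (difference-combination end₁ end₂ X chosen e)
        (trans (difference-combination end₁ end₂ Y side e)
               (GF2.sum-cong-≗ (λ j → cong (Y j ∧_) (sym (proj₂ (proj₂ (basis∈ j)) e))))))

    coefficient : ∀ X Y t i → coboundary G (sum-of X Y t) · star G (enumerate S i) ≡ X i
    coefficient X Y t i = begin
      coboundary G (sum-of X Y t) · s                                ≡⟨ ·-congˡ s (coboundary-sum-of X Y t) ⟩
      (λ e → combination X stars e xor combination Y basis e) · s    ≡⟨ ·-distribʳ-xor s (combination X stars) (combination Y basis) ⟩
      combination X stars · s xor combination Y basis · s            ≡⟨ cong₂ _xor_ (combination-dual X stars s i (stars-orthonormal i))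
                                                                          (combination-⊥ Y basis s (λ j → cycle⊥star G (proj₁ (basis∈ j)) (enumerate S i))) ⟩
      X i xor false                                                  ≡⟨ xor-identityʳ (X i) ⟩
      X i                                                            ∎
      where
      open ≡-Reasoning
      stars = star G ∘ enumerate S
      s = star G (enumerate S i)

    injective : ∀ X X′ Y Y′ t t′ → sum-of X Y t ≗ sum-of X′ Y′ t′ → X ≗ X′ × Y ≗ Y′ × t ≗ t′
    injective X X′ Y Y′ t t′ eq = X≗ , Y≗ , λ { zero → t≡ }
      where
      ∂-eq : coboundary G (sum-of X Y t) ≗ coboundary G (sum-of X′ Y′ t′)
      ∂-eq e = cong₂ _xor_ (eq (end₁ e)) (eq (end₂ e))

      X≗ : X ≗ X′
      X≗ i = trans (sym (coefficient X Y t i)) (trans (·-congˡ (star G (enumerate S i)) ∂-eq) (coefficient X′ Y′ t′ i))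

      basis-eq : combination Y basis ≗ combination Y′ basis
      basis-eq e = xor-cancelˡ (combination X (star G ∘ enumerate S) e)
        (trans (sym (coboundary-sum-of X Y t e)) (trans (∂-eq e) (trans (coboundary-sum-of X′ Y′ t′ e)
          (cong (_xor _) (sym (combination-cong (star G ∘ enumerate S) X≗ e))))))

      Y≗ : Y ≗ Y′
      Y≗ j = xor≡false⇒≡ (independent (λ j → Y j xor Y′ j)
        (λ e → trans (combination-xor Y Y′ basis e)
          (trans (cong (_xor _) (basis-eq e)) (xor-same (combination Y′ basis e)))) j)

      u : Fin (#V G)
      u = fromℕ< 0<v

      t≡ : t zero ≡ t′ zero
      t≡ = xor-cancelˡ (combination Y side u) (xor-cancelˡ (combination X chosen u)
        (trans (eq u) (sym (cong₂ (λ x y → x xor (y xor t′ zero)) (combination-cong chosen X≗ u) (combination-cong side Y≗ u)))))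


  zigzag-bound : (M : Map n) → Planar M → G ≅ graph M → ∣ S ∣ ℕ.+ #zigzags M ℕ.≤ #V G
  zigzag-bound M (connected , euler) G≅M =
    ℕ.+-cancelʳ-≤ #F (∣ S ∣ ℕ.+ #zigzags M) (#V G) (begin
      (∣ S ∣ ℕ.+ #zigzags M) ℕ.+ #F   ≡⟨ ℕ.+-assoc ∣ S ∣ (#zigzags M) #F ⟩
      -- The stars are carried to `graph M` by composing vertex sets with the inverse isomorphism,
      -- which preserves scalar products of coboundaries.
      ∣ S ∣ ℕ.+ (#zigzags M ℕ.+ #F)   ≤⟨ MapSpaces.orthonormal-bound M connected (λ j → kronecker (enumerate S j) ∘ Inverse.from (_≅_.onV G≅M))
                                           (λ i j → trans (coboundary-·-≅ G≅M (kronecker (enumerate S j)) (kronecker (enumerate S i))) (stars-orthonormal i j)) ⟩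
      2 ℕ.+ #SQ M                     ≡⟨ euler-ℕ (#V (graph M)) (#SQ M) #F euler ⟨
      #V (graph M) ℕ.+ #F                     ≡⟨ cong (ℕ._+ #F) (↔⇒≡ (_≅_.onV G≅M)) ⟨
      #V G ℕ.+ #F                     ∎)
    where
    open ℕ.≤-Reasoning
    #F = #classes (cycles (Map.f M) (Map.a M))

    euler-ℕ : ∀ v e f → + v - + e ℤ.+ + f ≡ + 2 → v ℕ.+ f ≡ 2 ℕ.+ e
    euler-ℕ v e f χ≡2 = ℤ.+-injective (trans
      (ℤ-Solver.solve 3 (λ v e f → v ℤ-Solver.:+ f ℤ-Solver.:= ((v ℤ-Solver.:- e) ℤ-Solver.:+ f) ℤ-Solver.:+ e) refl (+ v) (+ e) (+ f))
      (cong (ℤ._+ + e) χ≡2))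

-- From natural numbers to integer differences

+-∸ : n ℕ.≤ m → + m - + n ≡ + (m ℕ.∸ n)
+-∸ {n} {m} n≤m = trans (ℤ.m-n≡m⊖n m n) (ℤ.⊖-≥ n≤m)

m+n≤o⇒m≤o-n : ∀ {m n o} → m ℕ.+ n ℕ.≤ o → + m ≤ + o - + n
m+n≤o⇒m≤o-n {m} {n} m+n≤o = subst (+ m ≤_) (sym (+-∸ (ℕ.m+n≤o⇒n≤o m m+n≤o))) (ℤ.+≤+ (ℕ.m+n≤o⇒m≤o∸n m m+n≤o))

theorem2p14 : (G : Graph) → Connected G → MapRich G → Loopless G → AllDegreesOdd G →
    (α : ℕ) → IsIndependenceNumber G α →
    ((γ : ℕ) → HasDimension (Bicycle G) γ → + α ≤ + #V G - + 1 - + γ)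
    × ((n : ℕ) (M : Map n) → Planar M → G ≅ graph M → + α ≤ + #V G - + #zigzags M)
theorem2p14 G (0<v , _) _ _ odd-degrees α ((S , indep , refl) , _) = bicycle , planar
  where
  bicycle : ∀ γ → HasDimension (Bicycle G) γ → + ∣ S ∣ ≤ + #V G - + 1 - + γ
  -- Since there is a vertex, truncated subtraction of 1 agrees with the integer one.
  bicycle γ dim = subst (λ t → + ∣ S ∣ ≤ t - + γ) (sym (+-∸ 0<v))
    (m+n≤o⇒m≤o-n (ℕ.m+n≤o⇒m≤o∸n (∣ S ∣ ℕ.+ γ) (subst (ℕ._≤ #V G) (sym (ℕ.+-assoc ∣ S ∣ γ 1))
      (bicycle-bound G odd-degrees S indep 0<v dim))))

  planar : ∀ n (M : Map n) → Planar M → G ≅ graph M → + ∣ S ∣ ≤ + #V G - + #zigzags M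
  planar n M M-planar G≅M = m+n≤o⇒m≤o-n (zigzag-bound G odd-degrees S indep M M-planar G≅M)
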